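{- (1) For all $A,B,C\in\widehat{\mathbb{F}_q^\times}$ and $\lambda\in\mathbb{F}_q$, $$\mathbb{P}_D^{(1)}\left[\begin{matrix}A; & B\\ & C\end{matrix};\lambda\right]=AC(-1)\,\overline{B}(-\lambda)\,\mathbb{P}_D^{(1)}\left[\begin{matrix}\overline{C}B; & B\\ & \overline{A}B\end{matrix};\frac1\lambda\right]+\delta(\lambda)\,J(A,C\overline{A}),$$ where for $\lambda=0$ the first term on the right is read as $0$ (since $\overline{B}(0)=0$). (2) Let $n\ge2$. For all $A,C,B_1,\dots,B_n\in\widehat{\mathbb{F}_q^\times}$ and $\lambda_1,\dots,\lambda_n\in\mathbb{F}_q^\times$, $$\mathbb{P}_D^{(n)}\left[\begin{matrix}A; & B_1\ \cdots\ B_n\\ & C\end{matrix};\lambda_1,\dots,\lambda_n\right]=AC(-1)\left(\prod_{i=1}^n\overline{B_i}(-\lambda_i)\right)\mathbb{P}_D^{(n)}\left[\begin{matrix}\overline{C}\prod_{i=1}^nB_i; & B_1\ \cdots\ B_n\\ & \overline{A}\prod_{i=1}^nB_i\end{matrix};\frac1{\lambda_1},\dots,\frac1{\lambda_n}\right].$$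
   Context: $\mathbb{F}_q$ is a finite field with $q=p^e$, $p$ an odd prime. $\widehat{\mathbb{F}_q^\times}$ is the group of complex-valued multiplicative characters of $\mathbb{F}_q^\times$; every character $\chi$, including the trivial one, is extended to $\mathbb{F}_q$ by $\chi(0)=0$, and $\overline{\chi}=\chi^{ -1}$. For $x\in\mathbb{F}_q$, $\delta(x)=1$ if $x=0$ and $\delta(x)=0$ otherwise. The Jacobi sum is $J(A,B)=\sum_{x\in\mathbb{F}_q}A(x)B(1-x)$. For $n\ge1$ the finite-field Appell-Lauricella period function is $$\mathbb{P}_D^{(n)}\left[\begin{matrix}A; & B_1\ \cdots\ B_n\\ & C\end{matrix};\lambda_1,\dots,\lambda_n\right]=\sum_{y\in\mathbb{F}_q}A(y)\,C\overline{A}(1-y)\,\overline{B_1}(1-\lambda_1y)\cdots\overline{B_n}(1-\lambda_ny).$$ -}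

module Defs where

open import Algebra.Bundles using (AbelianGroup; CommutativeRing)
open import Algebra.Morphism.Bundles using (GroupHomomorphism)
import Algebra.Properties.CommutativeMonoid.Sum as CommutativeMonoidSum
import Algebra.Properties.CommutativeSemigroup as CommutativeSemigroupProperties
import Algebra.Properties.Group as GroupProperties
import Algebra.Properties.AbelianGroup as AbelianGroupProperties
open import Data.Fin.Base using (Fin)
import Data.Fin.Properties as Fin
open import Data.Nat.Base as ℕ using (ℕ)
import Data.Nat.Properties as ℕ
open import Data.Product.Base using (∃; _×_; _,_; proj₁; proj₂)
open import Data.Rational.Base
  using (ℚ; 0ℚ; 1ℚ; ½; ∣_∣; 1/_; positive)
import Data.Rational.Properties as ℚ
open import Data.Vec.Functional using (Vector)
open import Function.Bundles using (Inverse)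
open import Level using (Level; _⊔_; 0ℓ) renaming (suc to lsuc)
open import Relation.Binary.Definitions using (Decidable)
open import Relation.Binary.PropositionalEquality as ≡ using (_≡_)
open import Relation.Nullary using (¬_; yes; no)
import Relation.Nullary.Decidable as Dec
open import Tactic.RingSolver using (solve-∀)
open import Tactic.RingSolver.Core.AlmostCommutativeRing
  using (AlmostCommutativeRing; fromCommutativeRing)

private
  variable
    c ℓ k ℓk : Level

  ℚ-ring : AlmostCommutativeRing 0ℓ 0ℓ
  ℚ-ring = fromCommutativeRing ℚ.+-*-commutativeRing
    (λ q → Dec.dec⇒maybe (0ℚ ℚ.≟ q))

------------------------------------------------------------------------

module Cauchy where

  open import Data.Rational.Base using (_+_; _*_; -_; _-_; _<_; _≤_)

  infix 4 _~_

  -- A sequence f is Cauchy exactly when f ~ f; for Cauchy sequences, f ~ g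
  -- says that f n - g n tends to 0.
  record _~_ (f g : ℕ → ℚ) : Set where
    constructor close
    field
      within : ∀ ε → 0ℚ < ε →
               ∃ λ N → ∀ m n → N ℕ.≤ m → N ℕ.≤ n → ∣ f m - g n ∣ < ε

  open _~_

  private
    ∣-∣-comm : ∀ p q → ∣ p - q ∣ ≡ ∣ q - p ∣
    ∣-∣-comm p q = ≡.trans (≡.cong ∣_∣ (lem p q)) (ℚ.∣-p∣≡∣p∣ (q - p))
      where
      lem : ∀ p q → p - q ≡ - (q - p)
      lem = solve-∀ ℚ-ring

    ˡ≤ : ∀ k l {n} → k ℕ.⊔ l ℕ.≤ n → k ℕ.≤ n
    ˡ≤ k l = ℕ.≤-trans (ℕ.m≤m⊔n k l)

    ʳ≤ : ∀ k l {n} → k ℕ.⊔ l ℕ.≤ n → l ℕ.≤ n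
    ʳ≤ k l = ℕ.≤-trans (ℕ.m≤n⊔m k l)

    half : ∀ {ε} → 0ℚ < ε → 0ℚ < ½ * ε
    half {ε} 0<ε = ℚ.positive⁻¹ (½ * ε) {{ℚ.pos*pos⇒pos ½ ε {{positive 0<ε}}}}

    halves : ∀ ε → ½ * ε + ½ * ε ≡ ε
    halves ε = ≡.trans (≡.sym (ℚ.*-distribʳ-+ ε ½ ½)) (ℚ.*-identityˡ ε)

    +-split : ∀ {x} y z {ε} → x ≡ y + z → ∣ y ∣ < ½ * ε → ∣ z ∣ < ½ * ε → ∣ x ∣ < ε
    +-split {x} y z {ε} x≡y+z y< z< = begin-strict
      ∣ x ∣              ≡⟨ ≡.cong ∣_∣ x≡y+z ⟩
      ∣ y + z ∣          ≤⟨ ℚ.∣p+q∣≤∣p∣+∣q∣ y z ⟩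
      ∣ y ∣ + ∣ z ∣      <⟨ ℚ.+-mono-< y< z< ⟩
      ½ * ε + ½ * ε      ≡⟨ halves ε ⟩
      ε                  ∎
      where open ℚ.≤-Reasoning

  ~-sym : ∀ {f g} → f ~ g → g ~ f
  ~-sym {f} {g} f~g .within ε 0<ε =
    let N , h = f~g .within ε 0<ε in
    N , λ m n N≤m N≤n → ≡.subst (_< ε) (∣-∣-comm (f n) (g m)) (h n m N≤n N≤m)

  ~-trans : ∀ {f g h} → f ~ g → g ~ h → f ~ h
  ~-trans {f} {g} {h} f~g g~h .within ε 0<ε =
    let N₁ , h₁ = f~g .within (½ * ε) (half 0<ε)
        N₂ , h₂ = g~h .within (½ * ε) (half 0<ε)
    in N₁ ℕ.⊔ N₂ , λ m n N≤m N≤n →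
      +-split (f m - g n) (g n - h n) (lem (f m) (g n) (h n))
        (h₁ m n (ˡ≤ N₁ N₂ N≤m) (ˡ≤ N₁ N₂ N≤n))
        (h₂ n n (ʳ≤ N₁ N₂ N≤n) (ʳ≤ N₁ N₂ N≤n))
    where
    lem : ∀ p q r → p - r ≡ (p - q) + (q - r)
    lem = solve-∀ ℚ-ring

  ~-resp : ∀ {f g h} → f ~ g → (∀ n → g n ≡ h n) → f ~ h
  ~-resp {f} f~g g≡h .within ε 0<ε =
    let N , b = f~g .within ε 0<ε in
    N , λ m n N≤m N≤n → ≡.subst (λ x → ∣ f m - x ∣ < ε) (g≡h n) (b m n N≤m N≤n)

  const~ : ∀ q → (λ _ → q) ~ (λ _ → q)
  const~ q .within ε 0<ε =
    0 , λ _ _ _ _ → ≡.subst (_< ε) (≡.cong ∣_∣ (≡.sym (ℚ.+-inverseʳ q))) 0<ε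

  -~ : ∀ {f g} → f ~ g → (λ n → - f n) ~ (λ n → - g n)
  -~ {f} {g} f~g .within ε 0<ε =
    let N , b = f~g .within ε 0<ε in
    N , λ m n N≤m N≤n →
      ≡.subst (_< ε) (≡.trans (∣-∣-comm (f m) (g n)) (≡.cong ∣_∣ (lem (f m) (g n))))
        (b m n N≤m N≤n)
    where
    lem : ∀ p q → q - p ≡ - p - - q
    lem = solve-∀ ℚ-ring

  +~ : ∀ {f f′ g g′} → f ~ f′ → g ~ g′ → (λ n → f n + g n) ~ (λ n → f′ n + g′ n)
  +~ {f} {f′} {g} {g′} f~f′ g~g′ .within ε 0<ε =
    let N₁ , b₁ = f~f′ .within (½ * ε) (half 0<ε)
        N₂ , b₂ = g~g′ .within (½ * ε) (half 0<ε)
    in N₁ ℕ.⊔ N₂ , λ m n N≤m N≤n →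
      +-split (f m - f′ n) (g m - g′ n) (lem (f m) (f′ n) (g m) (g′ n))
        (b₁ m n (ˡ≤ N₁ N₂ N≤m) (ˡ≤ N₁ N₂ N≤n))
        (b₂ m n (ʳ≤ N₁ N₂ N≤m) (ʳ≤ N₁ N₂ N≤n))
    where
    lem : ∀ p p′ q q′ → (p + q) - (p′ + q′) ≡ (p - p′) + (q - q′)
    lem = solve-∀ ℚ-ring

  private
    bounded : ∀ {f g} → f ~ g →
              ∃ λ M → 0ℚ < M × ∃ λ N → ∀ n → N ℕ.≤ n → ∣ f n ∣ ≤ M
    bounded {f} {g} f~g = 1ℚ + ∣ g N ∣ , 0<M , N , bound
      where
      N = proj₁ (f~g .within 1ℚ (ℚ.positive⁻¹ 1ℚ))

      0<M : 0ℚ < 1ℚ + ∣ g N ∣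
      0<M = ℚ.+-mono-<-≤ (ℚ.positive⁻¹ 1ℚ) (ℚ.0≤∣p∣ (g N))

      lem : ∀ p q → p ≡ (p - q) + q
      lem = solve-∀ ℚ-ring

      bound : ∀ n → N ℕ.≤ n → ∣ f n ∣ ≤ 1ℚ + ∣ g N ∣
      bound n N≤n = begin
        ∣ f n ∣                   ≡⟨ ≡.cong ∣_∣ (lem (f n) (g N)) ⟩
        ∣ (f n - g N) + g N ∣     ≤⟨ ℚ.∣p+q∣≤∣p∣+∣q∣ (f n - g N) (g N) ⟩
        ∣ f n - g N ∣ + ∣ g N ∣
          ≤⟨ ℚ.+-monoˡ-≤ ∣ g N ∣
               (ℚ.<⇒≤ (proj₂ (f~g .within 1ℚ (ℚ.positive⁻¹ 1ℚ)) n N N≤n ℕ.≤-refl)) ⟩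
        1ℚ + ∣ g N ∣              ∎
        where open ℚ.≤-Reasoning

    shrink : ∀ M → 0ℚ < M → ∀ ε → 0ℚ < ε →
             ∃ λ η → 0ℚ < η ×
               (∀ x y → ∣ x ∣ ≤ M → ∣ y ∣ < η → ∣ x * y ∣ < ε)
    shrink M 0<M ε 0<ε = 1/M * ε , 0<η , bound
      where
      instance
        M-pos   = positive 0<M
        M-nz    = ℚ.pos⇒nonZero M
      1/M = 1/ M

      0<η : 0ℚ < 1/M * ε
      0<η = ℚ.positive⁻¹ (1/M * ε)
        {{ℚ.pos*pos⇒pos 1/M {{ℚ.1/pos⇒pos M}} ε {{positive 0<ε}}}}

      bound : ∀ x y → ∣ x ∣ ≤ M → ∣ y ∣ < 1/M * ε → ∣ x * y ∣ < ε
      bound x y x≤ y< = begin-strict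
        ∣ x * y ∣          ≡⟨ ℚ.∣p*q∣≡∣p∣*∣q∣ x y ⟩
        ∣ x ∣ * ∣ y ∣      ≤⟨ ℚ.*-monoʳ-≤-nonNeg ∣ y ∣ {{ℚ.∣-∣-nonNeg y}} x≤ ⟩
        M * ∣ y ∣          <⟨ ℚ.*-monoʳ-<-pos M y< ⟩
        M * (1/M * ε)      ≡⟨ ℚ.*-assoc M 1/M ε ⟨
        (M * 1/M) * ε      ≡⟨ ≡.cong (_* ε) (ℚ.*-inverseʳ M) ⟩
        1ℚ * ε             ≡⟨ ℚ.*-identityˡ ε ⟩
        ε                  ∎
        where open ℚ.≤-Reasoning

  *~ : ∀ {f f′ g g′} → f ~ f′ → g ~ g′ → (λ n → f n * g n) ~ (λ n → f′ n * g′ n)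
  *~ {f} {f′} {g} {g′} f~f′ g~g′ .within ε 0<ε =
    let M₁ , 0<M₁ , K₁ , f≤M₁  = bounded f~f′
        M₂ , 0<M₂ , K₂ , g′≤M₂ = bounded (~-sym g~g′)
        η₁ , 0<η₁ , s₁ = shrink M₁ 0<M₁ (½ * ε) (half 0<ε)
        η₂ , 0<η₂ , s₂ = shrink M₂ 0<M₂ (½ * ε) (half 0<ε)
        N₁ , b₁ = g~g′ .within η₁ 0<η₁
        N₂ , b₂ = f~f′ .within η₂ 0<η₂
        K = K₁ ℕ.⊔ K₂
        N = N₁ ℕ.⊔ N₂
    in K ℕ.⊔ N , λ m n ≤m ≤n →
      +-split (f m * (g m - g′ n)) (g′ n * (f m - f′ n))
        (lem (f m) (f′ n) (g m) (g′ n))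
        (s₁ (f m) (g m - g′ n) (f≤M₁ m (ˡ≤ K₁ K₂ (ˡ≤ K N ≤m)))
          (b₁ m n (ˡ≤ N₁ N₂ (ʳ≤ K N ≤m)) (ˡ≤ N₁ N₂ (ʳ≤ K N ≤n))))
        (s₂ (g′ n) (f m - f′ n) (g′≤M₂ n (ʳ≤ K₁ K₂ (ˡ≤ K N ≤n)))
          (b₂ m n (ʳ≤ N₁ N₂ (ʳ≤ K N ≤m)) (ʳ≤ N₁ N₂ (ʳ≤ K N ≤n))))
    where
    lem : ∀ p p′ q q′ → p * q - p′ * q′ ≡ p * (q - q′) + q′ * (p - p′)
    lem = solve-∀ ℚ-ring

  -- Without η, unification does not unfold arithmetic to rational sequences.
  record Real : Set where
    no-eta-equality
    field
      seq    : ℕ → ℚ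
      cauchy : seq ~ seq

  open Real public

  infix 4 _≃_

  record _≃_ (x y : Real) : Set where
    constructor equal
    field
      seq~ : seq x ~ seq y

  open _≃_

  ≡⇒≃ : ∀ x y → (∀ n → seq x n ≡ seq y n) → x ≃ y
  ≡⇒≃ x _ x≡y = equal (~-resp (cauchy x) x≡y)

  infixl 6 _+ᴿ_
  infixl 7 _*ᴿ_
  infix  8 -ᴿ_

  _+ᴿ_ _*ᴿ_ : Real → Real → Real
  (x +ᴿ y) .seq n  = seq x n + seq y n
  (x +ᴿ y) .cauchy = +~ (cauchy x) (cauchy y)
  (x *ᴿ y) .seq n  = seq x n * seq y n
  (x *ᴿ y) .cauchy = *~ (cauchy x) (cauchy y)

  -ᴿ_ : Real → Real
  (-ᴿ x) .seq n  = - seq x n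
  (-ᴿ x) .cauchy = -~ (cauchy x)

  const : ℚ → Real
  const q .seq _  = q
  const q .cauchy = const~ q

  ℝ : CommutativeRing 0ℓ 0ℓ
  ℝ = record
    { Carrier = Real
    ; _≈_ = _≃_
    ; _+_ = _+ᴿ_
    ; _*_ = _*ᴿ_
    ; -_  = -ᴿ_
    ; 0#  = const 0ℚ
    ; 1#  = const 1ℚ
    ; isCommutativeRing = record
      { isRing = record
        { +-isAbelianGroup = record
          { isGroup = record
            { isMonoid = record
              { isSemigroup = record
                { isMagma = record
                  { isEquivalence = record
                    { refl  = λ {x} → equal (cauchy x)
                    ; sym   = λ p → equal (~-sym (seq~ p))
                    ; trans = λ p q → equal (~-trans (seq~ p) (seq~ q))
                    }
                  ; ∙-cong = λ p q → equal (+~ (seq~ p) (seq~ q))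
                  }
                ; assoc = λ x y z → ≡⇒≃ (x +ᴿ y +ᴿ z) (x +ᴿ (y +ᴿ z))
                    (λ n → ℚ.+-assoc (seq x n) (seq y n) (seq z n))
                }
              ; identity =
                  (λ x → ≡⇒≃ (const 0ℚ +ᴿ x) x (λ n → ℚ.+-identityˡ (seq x n)))
                , (λ x → ≡⇒≃ (x +ᴿ const 0ℚ) x (λ n → ℚ.+-identityʳ (seq x n)))
              }
            ; inverse =
                (λ x → ≡⇒≃ (-ᴿ x +ᴿ x) (const 0ℚ) (λ n → ℚ.+-inverseˡ (seq x n)))
              , (λ x → ≡⇒≃ (x +ᴿ -ᴿ x) (const 0ℚ) (λ n → ℚ.+-inverseʳ (seq x n)))
            ; ⁻¹-cong = λ p → equal (-~ (seq~ p))
            }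
          ; comm = λ x y → ≡⇒≃ (x +ᴿ y) (y +ᴿ x) (λ n → ℚ.+-comm (seq x n) (seq y n))
          }
        ; *-cong = λ p q → equal (*~ (seq~ p) (seq~ q))
        ; *-assoc = λ x y z → ≡⇒≃ (x *ᴿ y *ᴿ z) (x *ᴿ (y *ᴿ z))
            (λ n → ℚ.*-assoc (seq x n) (seq y n) (seq z n))
        ; *-identity =
            (λ x → ≡⇒≃ (const 1ℚ *ᴿ x) x (λ n → ℚ.*-identityˡ (seq x n)))
          , (λ x → ≡⇒≃ (x *ᴿ const 1ℚ) x (λ n → ℚ.*-identityʳ (seq x n)))
        ; distrib =
            (λ x y z → ≡⇒≃ (x *ᴿ (y +ᴿ z)) (x *ᴿ y +ᴿ x *ᴿ z)
              (λ n → ℚ.*-distribˡ-+ (seq x n) (seq y n) (seq z n)))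
          , (λ x y z → ≡⇒≃ ((y +ᴿ z) *ᴿ x) (y *ᴿ x +ᴿ z *ᴿ x)
              (λ n → ℚ.*-distribʳ-+ (seq x n) (seq y n) (seq z n)))
        }
      ; *-comm = λ x y → ≡⇒≃ (x *ᴿ y) (y *ᴿ x) (λ n → ℚ.*-comm (seq x n) (seq y n))
      }
    }

open Cauchy public using (ℝ)

module ComplexNumbers where

  open Cauchy using (seq; ≡⇒≃)
  private module ℝ = CommutativeRing ℝ

  infix 4 _≈ᶜ_
  infixl 6 _+ᶜ_
  infixl 7 _*ᶜ_
  infix  8 -ᶜ_

  record Complex : Set where
    no-eta-equality
    field
      re im : ℝ.Carrier

  open Complex public

  infixr 4 _,_

  record _≈ᶜ_ (z w : Complex) : Set where
    constructor _,_
    field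
      re≈ : re z ℝ.≈ re w
      im≈ : im z ℝ.≈ im w

  _+ᶜ_ _*ᶜ_ : Complex → Complex → Complex
  (z +ᶜ w) .re = re z ℝ.+ re w
  (z +ᶜ w) .im = im z ℝ.+ im w
  (z *ᶜ w) .re = re z ℝ.* re w ℝ.- im z ℝ.* im w
  (z *ᶜ w) .im = re z ℝ.* im w ℝ.+ im z ℝ.* re w

  -ᶜ_ : Complex → Complex
  (-ᶜ z) .re = ℝ.- re z
  (-ᶜ z) .im = ℝ.- im z

  0ᶜ 1ᶜ : Complex
  0ᶜ .re = ℝ.0#
  0ᶜ .im = ℝ.0#
  1ᶜ .re = ℝ.1#
  1ᶜ .im = ℝ.0#

  private
    open import Data.Rational.Base using (_+_; _*_; _-_)

    *-assoc-re : ∀ p p′ q q′ r r′ →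
      (p * q - p′ * q′) * r - (p * q′ + p′ * q) * r′
      ≡ p * (q * r - q′ * r′) - p′ * (q * r′ + q′ * r)
    *-assoc-re = solve-∀ ℚ-ring

    *-assoc-im : ∀ p p′ q q′ r r′ →
      (p * q - p′ * q′) * r′ + (p * q′ + p′ * q) * r
      ≡ p * (q * r′ + q′ * r) + p′ * (q * r - q′ * r′)
    *-assoc-im = solve-∀ ℚ-ring

    *-comm-re : ∀ p p′ q q′ →
      p * q - p′ * q′ ≡ q * p - q′ * p′
    *-comm-re = solve-∀ ℚ-ring

    *-comm-im : ∀ p p′ q q′ →
      p * q′ + p′ * q ≡ q * p′ + q′ * p
    *-comm-im = solve-∀ ℚ-ring

    *-identityˡ-re : ∀ p p′ →
      1ℚ * p - 0ℚ * p′ ≡ p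
    *-identityˡ-re = solve-∀ ℚ-ring

    *-identityˡ-im : ∀ p p′ →
      1ℚ * p′ + 0ℚ * p ≡ p′
    *-identityˡ-im = solve-∀ ℚ-ring

    distribˡ-re : ∀ p p′ q q′ r r′ →
      p * (q + r) - p′ * (q′ + r′) ≡ (p * q - p′ * q′) + (p * r - p′ * r′)
    distribˡ-re = solve-∀ ℚ-ring

    distribˡ-im : ∀ p p′ q q′ r r′ →
      p * (q′ + r′) + p′ * (q + r) ≡ (p * q′ + p′ * q) + (p * r′ + p′ * r)
    distribˡ-im = solve-∀ ℚ-ring

    *-identityʳ-re : ∀ p p′ →
      p * 1ℚ - p′ * 0ℚ ≡ p
    *-identityʳ-re = solve-∀ ℚ-ring

    *-identityʳ-im : ∀ p p′ →
      p * 0ℚ + p′ * 1ℚ ≡ p′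
    *-identityʳ-im = solve-∀ ℚ-ring

    distribʳ-re : ∀ p p′ q q′ r r′ →
      (q + r) * p - (q′ + r′) * p′ ≡ (q * p - q′ * p′) + (r * p - r′ * p′)
    distribʳ-re = solve-∀ ℚ-ring

    distribʳ-im : ∀ p p′ q q′ r r′ →
      (q + r) * p′ + (q′ + r′) * p ≡ (q * p′ + q′ * p) + (r * p′ + r′ * p)
    distribʳ-im = solve-∀ ℚ-ring

    *-assocᶜ : ∀ z w v → ((z *ᶜ w) *ᶜ v) ≈ᶜ (z *ᶜ (w *ᶜ v))
    *-assocᶜ z w v =
        ≡⇒≃ (re ((z *ᶜ w) *ᶜ v)) (re (z *ᶜ (w *ᶜ v)))
          (λ n → *-assoc-re
            (seq (re z) n) (seq (im z) n) (seq (re w) n) (seq (im w) n) (seq (re v) n) (seq (im v) n))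
      , ≡⇒≃ (im ((z *ᶜ w) *ᶜ v)) (im (z *ᶜ (w *ᶜ v)))
          (λ n → *-assoc-im
            (seq (re z) n) (seq (im z) n) (seq (re w) n) (seq (im w) n) (seq (re v) n) (seq (im v) n))

    *-commᶜ : ∀ z w → (z *ᶜ w) ≈ᶜ (w *ᶜ z)
    *-commᶜ z w =
        ≡⇒≃ (re (z *ᶜ w)) (re (w *ᶜ z))
          (λ n → *-comm-re (seq (re z) n) (seq (im z) n) (seq (re w) n) (seq (im w) n))
      , ≡⇒≃ (im (z *ᶜ w)) (im (w *ᶜ z))
          (λ n → *-comm-im (seq (re z) n) (seq (im z) n) (seq (re w) n) (seq (im w) n))

    *-identityˡᶜ : ∀ z → (1ᶜ *ᶜ z) ≈ᶜ z
    *-identityˡᶜ z =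
        ≡⇒≃ (re (1ᶜ *ᶜ z)) (re z)
          (λ n → *-identityˡ-re (seq (re z) n) (seq (im z) n))
      , ≡⇒≃ (im (1ᶜ *ᶜ z)) (im z)
          (λ n → *-identityˡ-im (seq (re z) n) (seq (im z) n))

    distribˡᶜ : ∀ z w v → (z *ᶜ (w +ᶜ v)) ≈ᶜ ((z *ᶜ w) +ᶜ (z *ᶜ v))
    distribˡᶜ z w v =
        ≡⇒≃ (re (z *ᶜ (w +ᶜ v))) (re ((z *ᶜ w) +ᶜ (z *ᶜ v)))
          (λ n → distribˡ-re
            (seq (re z) n) (seq (im z) n) (seq (re w) n) (seq (im w) n) (seq (re v) n) (seq (im v) n))
      , ≡⇒≃ (im (z *ᶜ (w +ᶜ v))) (im ((z *ᶜ w) +ᶜ (z *ᶜ v)))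
          (λ n → distribˡ-im
            (seq (re z) n) (seq (im z) n) (seq (re w) n) (seq (im w) n) (seq (re v) n) (seq (im v) n))

    *-identityʳᶜ : ∀ z → (z *ᶜ 1ᶜ) ≈ᶜ z
    *-identityʳᶜ z =
        ≡⇒≃ (re (z *ᶜ 1ᶜ)) (re z)
          (λ n → *-identityʳ-re (seq (re z) n) (seq (im z) n))
      , ≡⇒≃ (im (z *ᶜ 1ᶜ)) (im z)
          (λ n → *-identityʳ-im (seq (re z) n) (seq (im z) n))

    distribʳᶜ : ∀ z w v → ((w +ᶜ v) *ᶜ z) ≈ᶜ ((w *ᶜ z) +ᶜ (v *ᶜ z))
    distribʳᶜ z w v =
        ≡⇒≃ (re ((w +ᶜ v) *ᶜ z)) (re ((w *ᶜ z) +ᶜ (v *ᶜ z)))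
          (λ n → distribʳ-re
            (seq (re z) n) (seq (im z) n) (seq (re w) n) (seq (im w) n) (seq (re v) n) (seq (im v) n))
      , ≡⇒≃ (im ((w +ᶜ v) *ᶜ z)) (im ((w *ᶜ z) +ᶜ (v *ᶜ z)))
          (λ n → distribʳ-im
            (seq (re z) n) (seq (im z) n) (seq (re w) n) (seq (im w) n) (seq (re v) n) (seq (im v) n))

  ℂ : CommutativeRing 0ℓ 0ℓ
  ℂ = record
    { Carrier = Complex
    ; _≈_ = _≈ᶜ_
    ; _+_ = _+ᶜ_
    ; _*_ = _*ᶜ_
    ; -_  = -ᶜ_
    ; 0#  = 0ᶜ
    ; 1#  = 1ᶜ
    ; isCommutativeRing = record
      { isRing = record
        { +-isAbelianGroup = record
          { isGroup = record
            { isMonoid = record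
              { isSemigroup = record
                { isMagma = record
                  { isEquivalence = record
                    { refl  = ℝ.refl , ℝ.refl
                    ; sym   = λ (p , q) → ℝ.sym p , ℝ.sym q
                    ; trans = λ (p , q) (p′ , q′) → ℝ.trans p p′ , ℝ.trans q q′
                    }
                  ; ∙-cong = λ (p , q) (p′ , q′) → ℝ.+-cong p p′ , ℝ.+-cong q q′
                  }
                ; assoc = λ z w v → ℝ.+-assoc (re z) (re w) (re v)
                                  , ℝ.+-assoc (im z) (im w) (im v)
                }
              ; identity = (λ z → ℝ.+-identityˡ (re z) , ℝ.+-identityˡ (im z))
                         , (λ z → ℝ.+-identityʳ (re z) , ℝ.+-identityʳ (im z))
              }
            ; inverse = (λ z → ℝ.-‿inverseˡ (re z) , ℝ.-‿inverseˡ (im z))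
                      , (λ z → ℝ.-‿inverseʳ (re z) , ℝ.-‿inverseʳ (im z))
            ; ⁻¹-cong = λ (p , q) → ℝ.-‿cong p , ℝ.-‿cong q
            }
          ; comm = λ z w → ℝ.+-comm (re z) (re w) , ℝ.+-comm (im z) (im w)
          }
        ; *-cong = λ (p , q) (p′ , q′) →
            ℝ.+-cong (ℝ.*-cong p p′) (ℝ.-‿cong (ℝ.*-cong q q′))
          , ℝ.+-cong (ℝ.*-cong p q′) (ℝ.*-cong q p′)
        ; *-assoc = *-assocᶜ
        ; *-identity = *-identityˡᶜ , *-identityʳᶜ
        ; distrib = distribˡᶜ , distribʳᶜ
        }
      ; *-comm = *-commᶜ
      }
    }

open ComplexNumbers public using (ℂ)

------------------------------------------------------------------------

module Units (R : CommutativeRing c ℓ) where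

  open CommutativeRing R
  open CommutativeSemigroupProperties *-commutativeSemigroup using (interchange)

  record Unit : Set (c ⊔ ℓ) where
    constructor unit
    field
      value    : Carrier
      inverse  : Carrier
      *-inverse : value * inverse ≈ 1#

  open Unit public

  private
    inverse-unique : ∀ {x y z} → x * y ≈ 1# → x * z ≈ 1# → y ≈ z
    inverse-unique {x} {y} {z} xy xz = begin
      y             ≈⟨ *-identityʳ y ⟨
      y * 1#        ≈⟨ *-congˡ xz ⟨
      y * (x * z)   ≈⟨ *-assoc y x z ⟨
      (y * x) * z   ≈⟨ *-congʳ (trans (*-comm y x) xy) ⟩
      1# * z        ≈⟨ *-identityˡ z ⟩
      z             ∎
      where open import Relation.Binary.Reasoning.Setoid setoid

  group : AbelianGroup (c ⊔ ℓ) ℓ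
  group = record
    { Carrier = Unit
    ; _≈_ = λ u v → value u ≈ value v
    ; _∙_ = λ u v → unit (value u * value v) (inverse u * inverse v)
        (trans (interchange _ _ _ _)
          (trans (*-cong (*-inverse u) (*-inverse v)) (*-identityˡ 1#)))
    ; ε = unit 1# 1# (*-identityˡ 1#)
    ; _⁻¹ = λ u → unit (inverse u) (value u) (trans (*-comm _ _) (*-inverse u))
    ; isAbelianGroup = record
      { isGroup = record
        { isMonoid = record
          { isSemigroup = record
            { isMagma = record
              { isEquivalence = record { refl = refl ; sym = sym ; trans = trans }
              ; ∙-cong = *-cong
              }
            ; assoc = λ _ _ _ → *-assoc _ _ _
            }
          ; identity = (λ _ → *-identityˡ _) , (λ _ → *-identityʳ _)
          }
        ; inverse = (λ u → trans (*-comm _ _) (*-inverse u)) , *-inverse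
        ; ⁻¹-cong = λ {u} {v} u≈v →
            inverse-unique (*-inverse u) (trans (*-congʳ u≈v) (*-inverse v))
        }
      ; comm = λ _ _ → *-comm _ _
      }
    }

------------------------------------------------------------------------

module Hom {a ℓa b ℓb} (G : AbelianGroup a ℓa) (H : AbelianGroup b ℓb) where

  private
    module G = AbelianGroup G
    module H = AbelianGroup H
  open GroupHomomorphism
  open CommutativeSemigroupProperties H.commutativeSemigroup using (interchange)
  open GroupProperties H.group using (ε⁻¹≈ε)
  open AbelianGroupProperties H using (⁻¹-∙-comm)

  Homomorphism : Set (a ⊔ b ⊔ ℓa ⊔ ℓb)
  Homomorphism = GroupHomomorphism G.rawGroup H.rawGroup

  private
    mkHom : (f : G.Carrier → H.Carrier) →
            (∀ {x y} → x G.≈ y → f x H.≈ f y) →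
            (∀ x y → f (x G.∙ y) H.≈ f x H.∙ f y) →
            f G.ε H.≈ H.ε →
            (∀ x → f (x G.⁻¹) H.≈ f x H.⁻¹) →
            Homomorphism
    mkHom f f-cong f-homo f-ε f-inv = record
      { ⟦_⟧ = f
      ; isGroupHomomorphism = record
        { isMonoidHomomorphism = record
          { isMagmaHomomorphism = record
            { isRelHomomorphism = record { cong = f-cong }
            ; homo = f-homo
            }
          ; ε-homo = f-ε
          }
        ; ⁻¹-homo = f-inv
        }
      }

  group : AbelianGroup (a ⊔ b ⊔ ℓa ⊔ ℓb) (a ⊔ ℓb)
  group = record
    { Carrier = Homomorphism
    ; _≈_ = λ φ ψ → ∀ x → ⟦ φ ⟧ x H.≈ ⟦ ψ ⟧ x
    ; _∙_ = λ φ ψ → mkHom (λ x → ⟦ φ ⟧ x H.∙ ⟦ ψ ⟧ x)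
        (λ x≈y → H.∙-cong (⟦⟧-cong φ x≈y) (⟦⟧-cong ψ x≈y))
        (λ x y → H.trans (H.∙-cong (homo φ x y) (homo ψ x y)) (interchange _ _ _ _))
        (H.trans (H.∙-cong (ε-homo φ) (ε-homo ψ)) (H.identityˡ H.ε))
        (λ x → H.trans (H.∙-cong (⁻¹-homo φ x) (⁻¹-homo ψ x)) (⁻¹-∙-comm _ _))
    ; ε = mkHom (λ _ → H.ε) (λ _ → H.refl) (λ _ _ → H.sym (H.identityˡ H.ε))
        H.refl (λ _ → H.sym ε⁻¹≈ε)
    ; _⁻¹ = λ φ → mkHom (λ x → ⟦ φ ⟧ x H.⁻¹)
        (λ x≈y → H.⁻¹-cong (⟦⟧-cong φ x≈y))
        (λ x y → H.trans (H.⁻¹-cong (homo φ x y)) (H.sym (⁻¹-∙-comm _ _)))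
        (H.trans (H.⁻¹-cong (ε-homo φ)) ε⁻¹≈ε)
        (λ x → H.⁻¹-cong (⁻¹-homo φ x))
    ; isAbelianGroup = record
      { isGroup = record
        { isMonoid = record
          { isSemigroup = record
            { isMagma = record
              { isEquivalence = record
                { refl  = λ _ → H.refl
                ; sym   = λ p x → H.sym (p x)
                ; trans = λ p q x → H.trans (p x) (q x)
                }
              ; ∙-cong = λ p q x → H.∙-cong (p x) (q x)
              }
            ; assoc = λ _ _ _ _ → H.assoc _ _ _
            }
          ; identity = (λ _ _ → H.identityˡ _) , (λ _ _ → H.identityʳ _)
          }
        ; inverse = (λ _ _ → H.inverseˡ _) , (λ _ _ → H.inverseʳ _)
        ; ⁻¹-cong = λ p x → H.⁻¹-cong (p x)
        }
      ; comm = λ _ _ _ → H.comm _ _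
      }
    }

------------------------------------------------------------------------


record FiniteField (q : ℕ) c ℓ : Set (lsuc (c ⊔ ℓ)) where
  field
    commutativeRing : CommutativeRing c ℓ

  open CommutativeRing commutativeRing public

  field
    0≉1         : ¬ (0# ≈ 1#)
    invertible  : ∀ x → ¬ (x ≈ 0#) → ∃ λ y → x * y ≈ 1#
    enumeration : Inverse (≡.setoid (Fin q)) setoid

  element : Fin q → Carrier
  element = Inverse.to enumeration

  infix 4 _≟_
  _≟_ : Decidable _≈_
  x ≟ y = Dec.map′ injective (Inverse.from-cong enumeration)
            (Inverse.from enumeration x Fin.≟ Inverse.from enumeration y)
    where
    injective : Inverse.from enumeration x ≡ Inverse.from enumeration y → x ≈ y
    injective eq = trans (sym (Inverse.strictlyInverseˡ enumeration x))
      (trans (Inverse.to-cong enumeration eq) (Inverse.strictlyInverseˡ enumeration y))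

  -- The inverse is made total by 0 ⁻¹ = 0.
  infix 8 _⁻¹
  _⁻¹ : Carrier → Carrier
  x ⁻¹ with x ≟ 0#
  ... | yes _   = 0#
  ... | no  x≉0 = proj₁ (invertible x x≉0)

-- Used with K = ℂ. Since 𝔽 is a field, its units are its nonzero elements, so
-- a Character is a group homomorphism 𝔽ˣ → Kˣ.
module CharacterSums {q} (𝔽 : FiniteField q c ℓ) (K : CommutativeRing k ℓk) where

  open FiniteField 𝔽
  private module K = CommutativeRing K

  characters : AbelianGroup (c ⊔ ℓ ⊔ k ⊔ ℓk) (c ⊔ ℓ ⊔ ℓk)
  characters = Hom.group (Units.group commutativeRing) (Units.group K)

  open AbelianGroup characters public using ()
    renaming (Carrier to Character; _∙_ to _·_; _⁻¹ to conj)

  ∏ᶜ : ∀ {n} → Vector Character n → Character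
  ∏ᶜ = CommutativeMonoidSum.sum (AbelianGroup.commutativeMonoid characters)

  -- χ ⟨ x ⟩ is χ(x) for χ extended by χ(0) = 0.
  infix 9 _⟨_⟩
  _⟨_⟩ : Character → Carrier → K.Carrier
  χ ⟨ x ⟩ with x ≟ 0#
  ... | yes _   = K.0#
  ... | no  x≉0 = Units.value (GroupHomomorphism.⟦_⟧ χ
                    (Units.unit x (proj₁ (invertible x x≉0)) (proj₂ (invertible x x≉0))))

  δ : Carrier → K.Carrier
  δ x with x ≟ 0#
  ... | yes _ = K.1#
  ... | no  _ = K.0#

  ∏ : ∀ {n} → Vector K.Carrier n → K.Carrier
  ∏ = CommutativeMonoidSum.sum K.*-commutativeMonoid

  ∑ᶠ : (Carrier → K.Carrier) → K.Carrier
  ∑ᶠ f = CommutativeMonoidSum.sum K.+-commutativeMonoid (λ i → f (element i))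

  J : Character → Character → K.Carrier
  J A B = ∑ᶠ λ x → A ⟨ x ⟩ K.* B ⟨ 1# - x ⟩

  ℙᴰ : ∀ {n} → Character → Vector Character n → Character → Vector Carrier n → K.Carrier
  ℙᴰ A B C λs = ∑ᶠ λ y →
    A ⟨ y ⟩ K.* (C · conj A) ⟨ 1# - y ⟩ K.* ∏ λ i → conj (B i) ⟨ 1# - λs i * y ⟩

module Submission where

-- The terms of the two sums match one by one under the involution y ↦ y⁻¹ of
-- 𝔽 (with 0⁻¹ = 0), because 1 - t y⁻¹ = (- t) (1 - t⁻¹ y) y⁻¹ when t and y are
-- nonzero. The terms at y = 0 vanish on both sides.

open import Defs
open import Algebra.Bundles using (AbelianGroup; CommutativeMonoid; CommutativeRing)
open import Algebra.Morphism.Bundles using (GroupHomomorphism)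
import Algebra.Properties.AbelianGroup as AbelianGroupProperties
import Algebra.Properties.CommutativeSemigroup as CommutativeSemigroupProperties
import Algebra.Properties.CommutativeMonoid.Sum as CommutativeMonoidSum
import Algebra.Properties.Ring as RingProperties
import Algebra.Properties.Semiring.Sum as SemiringSum
import Algebra.Solver.CommutativeMonoid as CommutativeMonoidSolver
open import Data.Empty using (⊥-elim)
open import Data.Fin.Base using (Fin; zero; suc)
open import Data.Fin.Permutation using (Permutation′; permutation)
open import Data.Nat.Base as ℕ using (ℕ; zero; suc)
open import Data.Nat.Divisibility using (_∣_)
open import Data.Nat.Primality using (Prime)
open import Data.Product.Base using (_×_; _,_; proj₁; proj₂)
open import Data.Vec.Functional using (Vector; []; _∷_)
open import Function.Base using (case_of_)
open import Function.Bundles using (Inverse)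
open import Level using (Level)
open import Relation.Binary.PropositionalEquality as ≡ using (_≡_)
import Relation.Binary.Reasoning.Setoid as SetoidReasoning
open import Relation.Nullary using (¬_; yes; no)

private
  variable
    c ℓ k ℓk : Level

-- Identities in abelian groups and commutative monoids.

module AbelianGroupIdentities (G : AbelianGroup c ℓ) where

  open AbelianGroup G
  open AbelianGroupProperties G using (⁻¹-∙-comm; ⁻¹-involutive; xyx⁻¹≈y)
  open CommutativeSemigroupProperties commutativeSemigroup using (interchange)
  open SetoidReasoning setoid

  x∙[y∙x⁻¹]≈y : ∀ x y → x ∙ (y ∙ x ⁻¹) ≈ y
  x∙[y∙x⁻¹]≈y x y = trans (sym (assoc x y (x ⁻¹))) (xyx⁻¹≈y x y)

  -- Read with `x = A`, `y = C` and `z` the product of the `B i`: the new `C` times the conjugate of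
  -- the new `A` is the old `C · conj A`, so the factor at `1# - y` keeps its character.
  [x⁻¹∙z]∙[y⁻¹∙z]⁻¹≈y∙x⁻¹ : ∀ x y z → (x ⁻¹ ∙ z) ∙ (y ⁻¹ ∙ z) ⁻¹ ≈ y ∙ x ⁻¹
  [x⁻¹∙z]∙[y⁻¹∙z]⁻¹≈y∙x⁻¹ x y z = begin
    (x ⁻¹ ∙ z) ∙ (y ⁻¹ ∙ z) ⁻¹          ≈⟨ ∙-congˡ (⁻¹-∙-comm (y ⁻¹) z) ⟨
    (x ⁻¹ ∙ z) ∙ ((y ⁻¹) ⁻¹ ∙ z ⁻¹)     ≈⟨ interchange _ _ _ _ ⟩
    (x ⁻¹ ∙ (y ⁻¹) ⁻¹) ∙ (z ∙ z ⁻¹)     ≈⟨ ∙-cong (∙-congˡ (⁻¹-involutive y)) (inverseʳ z) ⟩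
    (x ⁻¹ ∙ y) ∙ ε                      ≈⟨ identityʳ _ ⟩
    x ⁻¹ ∙ y                            ≈⟨ comm (x ⁻¹) y ⟩
    y ∙ x ⁻¹                            ∎

module CommutativeMonoidIdentities (M : CommutativeMonoid c ℓ) where

  open CommutativeMonoid M

  -- Here `m`, `n` are the constants pulled out of the sum, `a`, `d`, `r` the values at `w = y⁻¹`,
  -- and `b`, `q` the factors of the new term.
  regroup : ∀ a m b d n q r →
    (a ∙ (m ∙ b ∙ d)) ∙ (n ∙ q ∙ r) ≈ (m ∙ n) ∙ (a ∙ d ∙ r ∙ b ∙ q)
  regroup = solve 7 (λ a m b d n q r →
    (a ⊕ ((m ⊕ b) ⊕ d)) ⊕ ((n ⊕ q) ⊕ r) ⊜ (m ⊕ n) ⊕ ((((a ⊕ d) ⊕ r) ⊕ b) ⊕ q)) refl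
    where open CommutativeMonoidSolver M using (solve; _⊕_; _⊜_)

-- Inversion in a finite field.

module FiniteFieldProperties {q} (𝔽 : FiniteField q c ℓ) where

  open FiniteField 𝔽
  open RingProperties ring using (-‿distribˡ-*; -‿distribʳ-*; -‿involutive; -0#≈0#)
  open SetoidReasoning setoid

  *-inverseʳ : ∀ {x} → ¬ (x ≈ 0#) → x * x ⁻¹ ≈ 1#
  *-inverseʳ {x} x≉0 with x ≟ 0#
  ... | yes x≈0  = ⊥-elim (x≉0 x≈0)
  ... | no  x≉0′ = proj₂ (invertible x x≉0′)

  0⁻¹≈0 : ∀ {x} → x ≈ 0# → x ⁻¹ ≈ 0#
  0⁻¹≈0 {x} x≈0 with x ≟ 0#
  ... | yes _   = refl
  ... | no  x≉0 = ⊥-elim (x≉0 x≈0)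

  invertible⇒≉0 : ∀ {x y} → x * y ≈ 1# → ¬ (x ≈ 0#)
  invertible⇒≉0 xy≈1 x≈0 = 0≉1 (trans (sym (trans (*-congʳ x≈0) (zeroˡ _))) xy≈1)

  ⁻¹-unique : ∀ {x y} → x * y ≈ 1# → y ≈ x ⁻¹
  ⁻¹-unique {x} {y} xy≈1 = begin
    y                ≈⟨ *-identityʳ y ⟨
    y * 1#           ≈⟨ *-congˡ (*-inverseʳ (invertible⇒≉0 xy≈1)) ⟨
    y * (x * x ⁻¹)   ≈⟨ *-assoc y x (x ⁻¹) ⟨
    y * x * x ⁻¹     ≈⟨ *-congʳ (trans (*-comm y x) xy≈1) ⟩
    1# * x ⁻¹        ≈⟨ *-identityˡ (x ⁻¹) ⟩
    x ⁻¹             ∎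

  -- `invertible` comes with no congruence in `x`; it follows from uniqueness of inverses.
  ⁻¹-cong : ∀ {x y} → x ≈ y → x ⁻¹ ≈ y ⁻¹
  ⁻¹-cong {x} {y} x≈y with y ≟ 0#
  ... | yes y≈0 = 0⁻¹≈0 (trans x≈y y≈0)
  ... | no  y≉0 = sym (⁻¹-unique (trans (*-congʳ x≈y) (proj₂ (invertible y y≉0))))

  ⁻¹-involutive : ∀ x → (x ⁻¹) ⁻¹ ≈ x
  ⁻¹-involutive x with x ≟ 0#
  ... | yes x≈0 = trans (0⁻¹≈0 refl) (sym x≈0)
  ... | no  x≉0 = sym (⁻¹-unique (trans (*-comm _ x) (proj₂ (invertible x x≉0))))

  1-0*y≈1 : ∀ {t y} → t ≈ 0# → 1# - t * y ≈ 1#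
  1-0*y≈1 {t} {y} t≈0 = begin
    1# - t * y    ≈⟨ +-congˡ (-‿cong (trans (*-congʳ t≈0) (zeroˡ y))) ⟩
    1# - 0#       ≈⟨ +-congˡ -0#≈0# ⟩
    1# + 0#       ≈⟨ +-identityʳ 1# ⟩
    1#            ∎

  -x*-y≈x*y : ∀ x y → - x * - y ≈ x * y
  -x*-y≈x*y x y = begin
    - x * - y       ≈⟨ -‿distribˡ-* x (- y) ⟨
    - (x * - y)     ≈⟨ -‿cong (-‿distribʳ-* x y) ⟨
    - - (x * y)     ≈⟨ -‿involutive (x * y) ⟩
    x * y           ∎

  -1*-1≈1 : - 1# * - 1# ≈ 1#
  -1*-1≈1 = trans (-x*-y≈x*y 1# 1#) (*-identityˡ 1#)

  -- The right side expands to `(t * s) * (y * w) - t * w`. Since `s` is any inverse of `t`, the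
  -- case `t = s = 1#` also handles the factor `1# - w`.
  1-t*w≈-t*[1-s*y]*w : ∀ {t s y w} → t * s ≈ 1# → y * w ≈ 1# →
                       1# - t * w ≈ - t * (1# - s * y) * w
  1-t*w≈-t*[1-s*y]*w {t} {s} {y} {w} ts≈1 yw≈1 = sym (begin
    - t * (1# - s * y) * w               ≈⟨ *-congʳ (distribˡ (- t) 1# (- (s * y))) ⟩
    (- t * 1# + - t * - (s * y)) * w     ≈⟨ *-congʳ (+-cong (*-identityʳ (- t)) (-x*-y≈x*y t (s * y))) ⟩
    (- t + t * (s * y)) * w              ≈⟨ distribʳ w (- t) (t * (s * y)) ⟩
    - t * w + t * (s * y) * w            ≈⟨ +-congʳ (-‿distribˡ-* t w) ⟨
    - (t * w) + t * (s * y) * w          ≈⟨ +-comm (- (t * w)) (t * (s * y) * w) ⟩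
    t * (s * y) * w - t * w              ≈⟨ +-congʳ (*-congʳ (*-assoc t s y)) ⟨
    t * s * y * w - t * w                ≈⟨ +-congʳ (*-assoc (t * s) y w) ⟩
    t * s * (y * w) - t * w              ≈⟨ +-congʳ (trans (*-cong ts≈1 yw≈1) (*-identityˡ 1#)) ⟩
    1# - t * w                           ∎)

  -- Sums run over `Fin q`, so inversion is carried to indices by the enumeration. The convention
  -- 0⁻¹ = 0 makes it an involution of the whole field, hence its own inverse.
  ⁻¹-permutation : Permutation′ q
  ⁻¹-permutation = permutation invert invert involutive involutive
    where
    open Inverse enumeration using (from; from-cong; strictlyInverseˡ; strictlyInverseʳ)

    invert : Fin q → Fin q
    invert i = from (element i ⁻¹)

    involutive : ∀ i → invert (invert i) ≡ i
    involutive i = ≡.trans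
      (from-cong (trans (⁻¹-cong (strictlyInverseˡ _)) (⁻¹-involutive (element i))))
      (strictlyInverseʳ i)

module CharacterSumProperties {q} (𝔽 : FiniteField q c ℓ) (K : CommutativeRing k ℓk) where

  open FiniteField 𝔽 hiding (zero)
  open FiniteFieldProperties 𝔽
  open CharacterSums 𝔽 K
  private
    module K = CommutativeRing K
    module X = AbelianGroup characters
    module Product = CommutativeMonoidSum K.*-commutativeMonoid
    module Sum = CommutativeMonoidSum K.+-commutativeMonoid
    open module 𝔽ˣ = Units commutativeRing using (Unit; unit)
    module Kˣ = Units K
    module 𝔽ˣ-group = AbelianGroup 𝔽ˣ.group
    module Kˣ-group = AbelianGroup Kˣ.group
    open GroupHomomorphism using (⟦_⟧; ⟦⟧-cong; homo; ε-homo; ⁻¹-homo)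
  open AbelianGroupIdentities characters
  open SetoidReasoning K.setoid

  -- Values of extended characters.

  ⟨⟩-zero : ∀ χ {x} → x ≈ 0# → χ ⟨ x ⟩ K.≈ K.0#
  ⟨⟩-zero χ {x} x≈0 with x ≟ 0#
  ... | yes _   = K.refl
  ... | no  x≉0 = ⊥-elim (x≉0 x≈0)

  -- Units are compared by `value` alone, so the inverse chosen in `χ ⟨ x ⟩` may be replaced by that
  -- of any `u`; this gives access to the homomorphism laws of `χ`.
  ⟨⟩-unit : ∀ χ {x} (u : Unit) → x ≈ 𝔽ˣ.value u → χ ⟨ x ⟩ K.≈ Kˣ.value (⟦ χ ⟧ u)
  ⟨⟩-unit χ {x} u x≈u with x ≟ 0#
  ... | yes x≈0 = ⊥-elim (invertible⇒≉0 (𝔽ˣ.*-inverse u) (trans (sym x≈u) x≈0))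
  ... | no  x≉0 = ⟦⟧-cong χ x≈u

  ⟨⟩-cong : ∀ χ {x y} → x ≈ y → χ ⟨ x ⟩ K.≈ χ ⟨ y ⟩
  ⟨⟩-cong χ {x} {y} x≈y with y ≟ 0#
  ... | yes y≈0 = ⟨⟩-zero χ (trans x≈y y≈0)
  ... | no  y≉0 = ⟨⟩-unit χ (unit y _ (proj₂ (invertible y y≉0))) x≈y

  ⟨⟩-congˡ : ∀ {χ ψ} → χ X.≈ ψ → ∀ x → χ ⟨ x ⟩ K.≈ ψ ⟨ x ⟩
  ⟨⟩-congˡ χ≈ψ x with x ≟ 0#
  ... | yes _ = K.refl
  ... | no  _ = χ≈ψ _

  ⟨⟩-· : ∀ χ ψ x → (χ · ψ) ⟨ x ⟩ K.≈ χ ⟨ x ⟩ K.* ψ ⟨ x ⟩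
  ⟨⟩-· χ ψ x with x ≟ 0#
  ... | yes _ = K.sym (K.zeroˡ K.0#)
  ... | no  _ = K.refl

  ⟨⟩-* : ∀ χ x y → χ ⟨ x * y ⟩ K.≈ χ ⟨ x ⟩ K.* χ ⟨ y ⟩
  ⟨⟩-* χ x y with x ≟ 0# | y ≟ 0#
  ... | yes x≈0 | _ = K.trans (⟨⟩-zero χ (trans (*-congʳ x≈0) (zeroˡ y))) (K.sym (K.zeroˡ _))
  ... | no _ | yes y≈0 = K.trans (⟨⟩-zero χ (trans (*-congˡ y≈0) (zeroʳ x))) (K.sym (K.zeroʳ _))
  ... | no x≉0 | no y≉0 = K.trans (⟨⟩-unit χ (u 𝔽ˣ-group.∙ v) refl) (homo χ u v)
    where
    u = unit x _ (proj₂ (invertible x x≉0))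
    v = unit y _ (proj₂ (invertible y y≉0))

  ⟨⟩-*³ : ∀ χ x y z → χ ⟨ x * y * z ⟩ K.≈ χ ⟨ x ⟩ K.* χ ⟨ y ⟩ K.* χ ⟨ z ⟩
  ⟨⟩-*³ χ x y z = K.trans (⟨⟩-* χ (x * y) z) (K.*-congʳ (⟨⟩-* χ x y))

  ⟨⟩-1 : ∀ χ {x} → x ≈ 1# → χ ⟨ x ⟩ K.≈ K.1#
  ⟨⟩-1 χ x≈1 = K.trans (⟨⟩-unit χ 𝔽ˣ-group.ε x≈1) (ε-homo χ)

  ⟨⟩-ε : ∀ {x} → ¬ (x ≈ 0#) → X.ε ⟨ x ⟩ K.≈ K.1#
  ⟨⟩-ε {x} x≉0 with x ≟ 0#
  ... | yes x≈0 = ⊥-elim (x≉0 x≈0)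
  ... | no  _   = K.refl

  -- A unit carries its inverse, so the inverse of `u` has value `y` by swapping components.
  ⟨⟩-conj : ∀ χ {x y} → x * y ≈ 1# → conj χ ⟨ x ⟩ K.≈ χ ⟨ y ⟩
  ⟨⟩-conj χ {x} {y} xy≈1 = begin
    conj χ ⟨ x ⟩                         ≈⟨ ⟨⟩-unit (conj χ) u refl ⟩
    Kˣ.value (⟦ χ ⟧ u Kˣ-group.⁻¹)       ≈⟨ ⁻¹-homo χ u ⟨
    Kˣ.value (⟦ χ ⟧ (u 𝔽ˣ-group.⁻¹))     ≈⟨ ⟨⟩-unit χ (u 𝔽ˣ-group.⁻¹) refl ⟨
    χ ⟨ y ⟩                              ∎
    where u = unit x y xy≈1

  -- At 0 this would fail for `n = 0`: the trivial character takes the value 0 there, the empty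
  -- product is 1.
  ⟨⟩-∏ᶜ : ∀ {n} (B : Vector Character n) {x} → ¬ (x ≈ 0#) →
          ∏ᶜ B ⟨ x ⟩ K.≈ ∏ (λ i → B i ⟨ x ⟩)
  ⟨⟩-∏ᶜ {zero}  B     x≉0 = ⟨⟩-ε x≉0
  ⟨⟩-∏ᶜ {suc n} B {x} x≉0 =
    K.trans (⟨⟩-· (B zero) _ x) (K.*-congˡ (⟨⟩-∏ᶜ (λ i → B (suc i)) x≉0))

  -- Finite products, and sums over the field.

  ∏-distrib-*³ : ∀ {n} (f g h : Vector K.Carrier n) →
                 ∏ (λ i → f i K.* g i K.* h i) K.≈ ∏ f K.* ∏ g K.* ∏ h
  ∏-distrib-*³ f g h = K.trans (Product.∑-distrib-+ (λ i → f i K.* g i) h)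
    (K.*-congʳ (Product.∑-distrib-+ f g))

  ∑ᶠ-cong : ∀ {f g} → (∀ x → f x K.≈ g x) → ∑ᶠ f K.≈ ∑ᶠ g
  ∑ᶠ-cong f≈g = Sum.sum-cong-≋ (λ i → f≈g (element i))

  ∑ᶠ-distribˡ-* : ∀ a f → ∑ᶠ (λ x → a K.* f x) K.≈ a K.* ∑ᶠ f
  ∑ᶠ-distribˡ-* a f = K.sym (SemiringSum.*-distribˡ-sum K.semiring a (λ i → f (element i)))

  ∑ᶠ-⁻¹ : ∀ {f} → (∀ {x y} → x ≈ y → f x K.≈ f y) → ∑ᶠ f K.≈ ∑ᶠ (λ x → f (x ⁻¹))
  ∑ᶠ-⁻¹ {f} f-cong = K.trans
    (Sum.sum-permute (λ i → f (element i)) ⁻¹-permutation)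
    -- The permuted index enumerates `element i ⁻¹` only up to `≈`, whence the need for `f-cong`.
    (Sum.sum-cong-≋ (λ i → f-cong (Inverse.strictlyInverseˡ enumeration (element i ⁻¹))))

  -- Periods under the substitution y ↦ y⁻¹.

  -- ℙᴰ A B C t is the case X = C · conj A and D i = conj (B i).
  term : ∀ {n} → Character → Character → Vector Character n → Vector Carrier n →
         Carrier → K.Carrier
  term A X D t y = A ⟨ y ⟩ K.* X ⟨ 1# - y ⟩ K.* ∏ (λ i → D i ⟨ 1# - t i * y ⟩)

  period : ∀ {n} → Character → Character → Vector Character n → Vector Carrier n → K.Carrier
  period A X D t = ∑ᶠ (term A X D t)

  term-cong : ∀ {n} A X (D : Vector Character n) t {x y} → x ≈ y →
              term A X D t x K.≈ term A X D t y
  term-cong A X D t x≈y = K.*-cong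
    (K.*-cong (⟨⟩-cong A x≈y) (⟨⟩-cong X (+-congˡ (-‿cong x≈y))))
    (Product.sum-cong-≋ (λ i → ⟨⟩-cong (D i) (+-congˡ (-‿cong (*-congˡ x≈y)))))

  term-zero : ∀ {n} A X (D : Vector Character n) t {y} → y ≈ 0# → term A X D t y K.≈ K.0#
  term-zero A X D t y≈0 =
    K.trans (K.*-congʳ (K.trans (K.*-congʳ (⟨⟩-zero A y≈0)) (K.zeroˡ _))) (K.zeroˡ _)

  period-congᵐ : ∀ {n} A {X Y} (D : Vector Character n) t → X X.≈ Y →
                 period A X D t K.≈ period A Y D t
  period-congᵐ A {X} {Y} D t X≈Y = ∑ᶠ-cong {term A X D t} {term A Y D t}
    (λ y → K.*-congʳ (K.*-congˡ (⟨⟩-congˡ {X} {Y} X≈Y (1# - y))))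

  -- Each factor of the substituted term leaves behind a value at `w = y⁻¹`. `E` is the character of
  -- `y` that collects these values and takes the place of `A`.
  module _ {n} (A E X : Character) (D : Vector Character n) (t s : Vector Carrier n)
           (ts≈1 : ∀ i → t i * s i ≈ 1#)
           (E-inverts : ∀ {y w} → y * w ≈ 1# →
             A ⟨ w ⟩ K.* X ⟨ w ⟩ K.* ∏ (λ i → D i ⟨ w ⟩) K.≈ E ⟨ y ⟩) where

    private
      factor : K.Carrier
      factor = X ⟨ - 1# ⟩ K.* ∏ (λ i → D i ⟨ - t i ⟩)

    term-inverse : ∀ {y w} → y * w ≈ 1# → term A X D t w K.≈ factor K.* term E X D s y
    term-inverse {y} {w} yw≈1 = begin
      A ⟨ w ⟩ K.* X ⟨ 1# - w ⟩ K.* ∏ (λ i → D i ⟨ 1# - t i * w ⟩)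
        ≈⟨ K.*-cong (K.*-congˡ X-factors) ∏-factors ⟩
      A ⟨ w ⟩ K.* (X ⟨ - 1# ⟩ K.* X ⟨ 1# - y ⟩ K.* X ⟨ w ⟩)
        K.* (∏ (λ i → D i ⟨ - t i ⟩) K.* ∏ (λ i → D i ⟨ 1# - s i * y ⟩) K.* ∏ (λ i → D i ⟨ w ⟩))
        ≈⟨ regroup _ _ _ _ _ _ _ ⟩
      factor K.* (A ⟨ w ⟩ K.* X ⟨ w ⟩ K.* ∏ (λ i → D i ⟨ w ⟩)
        K.* X ⟨ 1# - y ⟩ K.* ∏ (λ i → D i ⟨ 1# - s i * y ⟩))
        ≈⟨ K.*-congˡ (K.*-congʳ (K.*-congʳ (E-inverts yw≈1))) ⟩
      factor K.* term E X D s y ∎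
      where
      open CommutativeMonoidIdentities K.*-commutativeMonoid using (regroup)

      1-w≈-1*[1-y]*w : 1# - w ≈ - 1# * (1# - y) * w
      1-w≈-1*[1-y]*w = trans (+-congˡ (-‿cong (sym (*-identityˡ w))))
        (trans (1-t*w≈-t*[1-s*y]*w (*-identityˡ 1#) yw≈1)
          (*-congʳ (*-congˡ (+-congˡ (-‿cong (*-identityˡ y))))))

      X-factors : X ⟨ 1# - w ⟩ K.≈ X ⟨ - 1# ⟩ K.* X ⟨ 1# - y ⟩ K.* X ⟨ w ⟩
      X-factors = K.trans (⟨⟩-cong X 1-w≈-1*[1-y]*w) (⟨⟩-*³ X (- 1#) (1# - y) w)

      ∏-factors : ∏ (λ i → D i ⟨ 1# - t i * w ⟩)
        K.≈ ∏ (λ i → D i ⟨ - t i ⟩) K.* ∏ (λ i → D i ⟨ 1# - s i * y ⟩) K.* ∏ (λ i → D i ⟨ w ⟩)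
      ∏-factors = K.trans
        (Product.sum-cong-≋ λ i →
          K.trans (⟨⟩-cong (D i) (1-t*w≈-t*[1-s*y]*w (ts≈1 i) yw≈1))
            (⟨⟩-*³ (D i) (- t i) (1# - s i * y) w))
        (∏-distrib-*³ (λ i → D i ⟨ - t i ⟩) (λ i → D i ⟨ 1# - s i * y ⟩) (λ i → D i ⟨ w ⟩))

    term-⁻¹ : ∀ y → term A X D t (y ⁻¹) K.≈ factor K.* term E X D s y
    term-⁻¹ y = case y ≟ 0# of λ where
      (no  y≉0) → term-inverse (*-inverseʳ y≉0)
      -- `y` has no inverse here; both terms vanish because `A` and `E` are 0 at 0.
      (yes y≈0) → K.trans (term-zero A X D t (0⁻¹≈0 y≈0))
        (K.sym (K.trans (K.*-congˡ (term-zero E X D s y≈0)) (K.zeroʳ factor)))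

    period-inversion : period A X D t K.≈ factor K.* period E X D s
    period-inversion = begin
      period A X D t
        ≈⟨ ∑ᶠ-⁻¹ {term A X D t} (term-cong A X D t) ⟩
      ∑ᶠ (λ y → term A X D t (y ⁻¹))
        ≈⟨ ∑ᶠ-cong {λ y → term A X D t (y ⁻¹)} {λ y → factor K.* term E X D s y} term-⁻¹ ⟩
      ∑ᶠ (λ y → factor K.* term E X D s y)
        ≈⟨ ∑ᶠ-distribˡ-* factor (term E X D s) ⟩
      factor K.* period E X D s ∎

  -- Matching the characters of the two sides.

  AC⟨-1⟩≈CĀ⟨-1⟩ : ∀ A C → (A · C) ⟨ - 1# ⟩ K.≈ (C · conj A) ⟨ - 1# ⟩
  AC⟨-1⟩≈CĀ⟨-1⟩ A C = begin
    (A · C) ⟨ - 1# ⟩                      ≈⟨ ⟨⟩-· A C (- 1#) ⟩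
    A ⟨ - 1# ⟩ K.* C ⟨ - 1# ⟩             ≈⟨ K.*-comm _ _ ⟩
    -- -1 is its own inverse, so `A` and `conj A` agree there.
    C ⟨ - 1# ⟩ K.* A ⟨ - 1# ⟩             ≈⟨ K.*-congˡ (⟨⟩-conj A -1*-1≈1) ⟨
    C ⟨ - 1# ⟩ K.* conj A ⟨ - 1# ⟩        ≈⟨ ⟨⟩-· C (conj A) (- 1#) ⟨
    (C · conj A) ⟨ - 1# ⟩                 ∎

  -- The characters below are determined by the parameters only up to ≈. At
  -- K = ℂ, Agda would compare two definitionally equal characters by
  -- unfolding their homomorphism proofs down to Cauchy sequences; leaving the
  -- characters implicit confines conversion checking to their values. For the
  -- same reason ℙᴰ-inversion₁ keeps X, X′ and D, D′ apart.
  ℙᴰ-inversion : ∀ {n} (A C P : Character) (B : Vector Character n) (t s : Vector Carrier n) →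
    (∀ i → t i * s i ≈ 1#) →
    (∀ {x} → ¬ (x ≈ 0#) → P ⟨ x ⟩ K.≈ ∏ (λ i → B i ⟨ x ⟩)) →
    ∀ {M X E Y} {D : Vector Character n} →
    M X.≈ A · C → X X.≈ C · conj A → (∀ i → D i X.≈ conj (B i)) →
    E X.≈ conj C · P → Y X.≈ (conj A · P) · conj (conj C · P) →
    period A X D t K.≈ M ⟨ - 1# ⟩ K.* ∏ (λ i → D i ⟨ - t i ⟩) K.* period E Y D s
  ℙᴰ-inversion A C P B t s ts≈1 P≈∏B {M} {X} {E} {Y} {D} M≈AC X≈CĀ D≈B̄ E≈C̄P Y≈CĀ = begin
    period A X D t
      ≈⟨ period-inversion A E X D t s ts≈1 E-inverts ⟩
    X ⟨ - 1# ⟩ K.* ∏ (λ i → D i ⟨ - t i ⟩) K.* period E X D s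
      ≈⟨ K.*-cong (K.*-congʳ X⟨-1⟩≈M⟨-1⟩) (period-congᵐ E {X} {Y} D s X≈Y) ⟩
    M ⟨ - 1# ⟩ K.* ∏ (λ i → D i ⟨ - t i ⟩) K.* period E Y D s ∎
    where
    X⟨-1⟩≈M⟨-1⟩ : X ⟨ - 1# ⟩ K.≈ M ⟨ - 1# ⟩
    X⟨-1⟩≈M⟨-1⟩ = begin
      X ⟨ - 1# ⟩            ≈⟨ ⟨⟩-congˡ {X} {C · conj A} X≈CĀ (- 1#) ⟩
      (C · conj A) ⟨ - 1# ⟩ ≈⟨ AC⟨-1⟩≈CĀ⟨-1⟩ A C ⟨
      (A · C) ⟨ - 1# ⟩      ≈⟨ ⟨⟩-congˡ {M} {A · C} M≈AC (- 1#) ⟨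
      M ⟨ - 1# ⟩            ∎

    X≈Y : X X.≈ Y
    X≈Y = X.trans {X} {C · conj A} {Y} X≈CĀ
      (X.sym {Y} {C · conj A}
        (X.trans {Y} {(conj A · P) · conj (conj C · P)} {C · conj A}
          Y≈CĀ ([x⁻¹∙z]∙[y⁻¹∙z]⁻¹≈y∙x⁻¹ A C P)))

    D⟨w⟩≈B⟨y⟩ : ∀ {y w} → y * w ≈ 1# → ∀ i → D i ⟨ w ⟩ K.≈ B i ⟨ y ⟩
    D⟨w⟩≈B⟨y⟩ {y} {w} yw≈1 i = K.trans (⟨⟩-congˡ {D i} {conj (B i)} (D≈B̄ i) w)
      (⟨⟩-conj (B i) (trans (*-comm w y) yw≈1))

    AX≈C : A · X X.≈ C
    AX≈C = X.trans {A · X} {A · (C · conj A)} {C}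
      (X.∙-congˡ {A} {X} {C · conj A} X≈CĀ) (x∙[y∙x⁻¹]≈y A C)

    -- `A · X` is `C` and `D i ⟨ w ⟩` is `B i ⟨ y ⟩`, so the collected values are `C ⟨ w ⟩` times
    -- `P ⟨ y ⟩`, the value of `conj C · P` at `y`.
    E-inverts : ∀ {y w} → y * w ≈ 1# →
      A ⟨ w ⟩ K.* X ⟨ w ⟩ K.* ∏ (λ i → D i ⟨ w ⟩) K.≈ E ⟨ y ⟩
    E-inverts {y} {w} yw≈1 = begin
      A ⟨ w ⟩ K.* X ⟨ w ⟩ K.* ∏ (λ i → D i ⟨ w ⟩)
        ≈⟨ K.*-cong (K.sym (⟨⟩-· A X w)) (Product.sum-cong-≋ (D⟨w⟩≈B⟨y⟩ yw≈1)) ⟩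
      (A · X) ⟨ w ⟩ K.* ∏ (λ i → B i ⟨ y ⟩)
        ≈⟨ K.*-cong (⟨⟩-congˡ {A · X} {C} AX≈C w) (K.sym (P≈∏B (invertible⇒≉0 yw≈1))) ⟩
      C ⟨ w ⟩ K.* P ⟨ y ⟩
        ≈⟨ K.*-congʳ (⟨⟩-conj C yw≈1) ⟨
      conj C ⟨ y ⟩ K.* P ⟨ y ⟩
        ≈⟨ ⟨⟩-· (conj C) P y ⟨
      (conj C · P) ⟨ y ⟩
        ≈⟨ ⟨⟩-congˡ {E} {conj C · P} E≈C̄P y ⟨
      E ⟨ y ⟩ ∎

  -- One variable, including `t = 0`.

  δ-zero : ∀ {x} → x ≈ 0# → δ x K.≈ K.1#
  δ-zero {x} x≈0 with x ≟ 0#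
  ... | yes _   = K.refl
  ... | no  x≉0 = ⊥-elim (x≉0 x≈0)

  δ-nonzero : ∀ {x} → ¬ (x ≈ 0#) → δ x K.≈ K.0#
  δ-nonzero {x} x≉0 with x ≟ 0#
  ... | yes x≈0 = ⊥-elim (x≉0 x≈0)
  ... | no  _   = K.refl

  -- The only factor involving `t` becomes `D ⟨ 1# ⟩`, which is 1.
  period-zero : ∀ A X D {t} → t ≈ 0# → period A X (D ∷ []) (t ∷ []) K.≈ J A X
  period-zero A X D {t} t≈0 =
    ∑ᶠ-cong {term A X (D ∷ []) (t ∷ [])} {λ y → A ⟨ y ⟩ K.* X ⟨ 1# - y ⟩}
      (λ y → K.trans (K.*-congˡ (∏≈1 y)) (K.*-identityʳ _))
    where
    ∏≈1 : ∀ y → D ⟨ 1# - t * y ⟩ K.* K.1# K.≈ K.1#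
    ∏≈1 y = K.trans (K.*-identityʳ _) (⟨⟩-1 D (1-0*y≈1 t≈0))

  -- For nonzero `t`, `δ` removes the Jacobi sum and the inversion formula remains; for `t = 0` the
  -- first summand vanishes and the period is itself the Jacobi sum.
  ℙᴰ-inversion₁ : ∀ A B C t {M X X′ E Y D D′ : Character} →
    M X.≈ A · C → X X.≈ C · conj A → X′ X.≈ C · conj A → D X.≈ conj B → D′ X.≈ conj B →
    E X.≈ conj C · B → Y X.≈ (conj A · B) · conj (conj C · B) →
    period A X (D ∷ []) (t ∷ [])
      K.≈ M ⟨ - 1# ⟩ K.* D′ ⟨ - t ⟩ K.* period E Y (D ∷ []) (t ⁻¹ ∷ [])
          K.+ δ t K.* J A X′
  ℙᴰ-inversion₁ A B C t {M} {X} {X′} {E} {Y} {D} {D′} M≈AC X≈CĀ X′≈CĀ D≈B̄ D′≈B̄ E≈C̄B Y≈CĀ =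
    case t ≟ 0# of λ where
      (yes t≈0) → begin
        period A X (D ∷ []) (t ∷ [])
          ≈⟨ K.trans (period-congᵐ A {X} {X′} (D ∷ []) (t ∷ []) X≈X′) (period-zero A X′ D t≈0) ⟩
        J A X′
          ≈⟨ K.*-identityˡ _ ⟨
        K.1# K.* J A X′
          ≈⟨ K.*-congʳ (δ-zero t≈0) ⟨
        δ t K.* J A X′
          ≈⟨ K.+-identityˡ _ ⟨
        K.0# K.+ δ t K.* J A X′
          ≈⟨ K.+-congʳ (K.trans (K.*-congʳ (vanishing t≈0)) (K.zeroˡ _)) ⟨
        M ⟨ - 1# ⟩ K.* D′ ⟨ - t ⟩ K.* period′ K.+ δ t K.* J A X′ ∎
      (no t≉0) → begin
        period A X (D ∷ []) (t ∷ [])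
          -- `P` is taken to be `B` itself; the one-element product has the same values up to a
          -- trailing factor 1.
          ≈⟨ ℙᴰ-inversion A C B (B ∷ []) (t ∷ []) (t ⁻¹ ∷ [])
               (λ { zero → *-inverseʳ t≉0 }) (λ _ → K.sym (K.*-identityʳ _))
               {M} {X} {E} {Y} {D ∷ []} M≈AC X≈CĀ (λ { zero → D≈B̄ }) E≈C̄B Y≈CĀ ⟩
        M ⟨ - 1# ⟩ K.* (D ⟨ - t ⟩ K.* K.1#) K.* period′
          ≈⟨ K.*-congʳ (K.*-congˡ (K.trans (K.*-identityʳ _) D≈D′)) ⟩
        M ⟨ - 1# ⟩ K.* D′ ⟨ - t ⟩ K.* period′
          ≈⟨ K.+-identityʳ _ ⟨
        M ⟨ - 1# ⟩ K.* D′ ⟨ - t ⟩ K.* period′ K.+ K.0#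
          ≈⟨ K.+-congˡ (K.trans (K.*-congʳ (δ-nonzero t≉0)) (K.zeroˡ _)) ⟨
        M ⟨ - 1# ⟩ K.* D′ ⟨ - t ⟩ K.* period′ K.+ δ t K.* J A X′ ∎
    where
    open RingProperties ring using (-0#≈0#)

    period′ = period E Y (D ∷ []) (t ⁻¹ ∷ [])

    X≈X′ : X X.≈ X′
    X≈X′ = X.trans {X} {C · conj A} {X′} X≈CĀ (X.sym {X′} {C · conj A} X′≈CĀ)

    D≈D′ : D ⟨ - t ⟩ K.≈ D′ ⟨ - t ⟩
    D≈D′ = K.trans (⟨⟩-congˡ {D} {conj B} D≈B̄ (- t))
      (K.sym (⟨⟩-congˡ {D′} {conj B} D′≈B̄ (- t)))

    -- This also disposes of `period′`, formed at `t = 0` with the default 0⁻¹ = 0.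
    vanishing : t ≈ 0# → M ⟨ - 1# ⟩ K.* D′ ⟨ - t ⟩ K.≈ K.0#
    vanishing t≈0 = K.trans
      (K.*-congˡ (⟨⟩-zero D′ (trans (-‿cong t≈0) -0#≈0#))) (K.zeroʳ _)

-- Specialization to complex-valued characters.

proposition6p4 : {c ℓ : Level} (p e : ℕ) → Prime p → ¬ (2 ∣ p) →
  (𝔽 : FiniteField (p ℕ.^ e) c ℓ) →
  let open FiniteField 𝔽
      open CharacterSums 𝔽 ℂ
      module ℂ = CommutativeRing ℂ
  in
    ((A B C : Character) (t : Carrier) →
      ℙᴰ A (B ∷ []) C (t ∷ [])
        ℂ.≈ (A · C) ⟨ - 1# ⟩ ℂ.* conj B ⟨ - t ⟩
              ℂ.* ℙᴰ (conj C · B) (B ∷ []) (conj A · B) (t ⁻¹ ∷ [])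
            ℂ.+ δ t ℂ.* J A (C · conj A))
    ×
    ((n : ℕ) → 2 ℕ.≤ n →
      (A C : Character) (B : Vector Character n)
      (t : Vector Carrier n) → ((i : Fin n) → ¬ (t i ≈ 0#)) →
      ℙᴰ A B C t
        ℂ.≈ (A · C) ⟨ - 1# ⟩ ℂ.* ∏ (λ i → conj (B i) ⟨ - t i ⟩)
              ℂ.* ℙᴰ (conj C · ∏ᶜ B) B (conj A · ∏ᶜ B) (λ i → t i ⁻¹))
proposition6p4 p e _ _ 𝔽 =
    -- Each `ℂ.refl` identifies, value by value, a character of the statement with the one
    -- prescribed by the lemma.
    (λ A B C t → ℙᴰ-inversion₁ A B C t
      (λ _ → ℂ.refl) (λ _ → ℂ.refl) (λ _ → ℂ.refl) (λ _ → ℂ.refl) (λ _ → ℂ.refl)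
      (λ _ → ℂ.refl) (λ _ → ℂ.refl))
  , λ n _ A C B t t≉0 →
      ℙᴰ-inversion A C (∏ᶜ B) B t (λ i → t i ⁻¹) (λ i → *-inverseʳ (t≉0 i)) (⟨⟩-∏ᶜ B)
        (λ _ → ℂ.refl) (λ _ → ℂ.refl) (λ _ _ → ℂ.refl) (λ _ → ℂ.refl) (λ _ → ℂ.refl)
  where
  module ℂ = CommutativeRing ℂ
  open FiniteField 𝔽 using (_⁻¹)
  open FiniteFieldProperties 𝔽 using (*-inverseʳ)
  open CharacterSums 𝔽 ℂ using (∏ᶜ)
  open CharacterSumProperties 𝔽 ℂ
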